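{- Let $n$ and $s$ be positive integers and let $\mathcal{F} \subset \mathbb{S}^{n-1}$ be a spherical $s$-distance set in $\mathbb{R}^n$, with set of inner products $\mathcal{P}(\mathcal{F}) = \{\langle x, y\rangle \mid x, y \in \mathcal{F},\ x \neq y\} = \{t_1, \dots, t_s\}$ (where $t_1,\dots,t_s$ are the $s$ distinct values). If $t_1 + \dots + t_s = 0$, then $$|\mathcal{F}| \le \binom{n+s-1}{s} + \binom{n+s-4}{s-3}.$$
   Context: $\mathbb{R}^n$ carries the standard inner product $\langle\cdot,\cdot\rangle$ and the Euclidean norm $\|\cdot\|$, and $\mathbb{S}^{n-1}$ is the unit sphere centered at the origin in $\mathbb{R}^n$. A finite subset $\mathcal{F} \subset \mathbb{R}^n$ is an $s$-distance set if the set $\mathcal{D}(\mathcal{F}) = \{\|x-y\| \mid x,y\in\mathcal{F},\ x\neq y\}$ has cardinality exactly $s$. It is a spherical $s$-distance set if moreover $\mathcal{F}\subset\mathbb{S}^{n-1}$. For a spherical $s$-distance set, $\mathcal{D}(\mathcal{F})$ is in bijection with $\mathcal{P}(\mathcal{F})$ (since $\|x-y\|^2 = 2-2\langle x,y\rangle$ on the unit sphere), so $\mathcal{P}(\mathcal{F})$ also has exactly $s$ elements. Convention: a binomial coefficient $\binom{a}{b}$ with $b<0$ is $0$ (so the second term vanishes when $s\le 2$). -}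

module Defs where

open import Algebra.Bundles.Raw using (RawMonoid)
open import Algebra.Bundles using (CommutativeMonoid)
import Algebra.Definitions.RawMonoid as RawMonoidSum
open import Data.Fin.Base using (Fin)
open import Data.Integer.Base using (ℤ; +_; -[1+_])
open import Data.Nat.Base as ℕ using (ℕ; _⊔_)
import Data.Nat.Properties as ℕ
open import Data.Nat.Combinatorics using (_C_)
open import Data.Product.Base using (Σ; ∃; ∃₂; _×_; _,_)
open import Data.Rational.Base as ℚ using (ℚ; 0ℚ; 1ℚ; ∣_∣; 1/_)
import Data.Rational.Properties as ℚ
open import Data.Rational.Solver using (module +-*-Solver)
open import Data.Vec.Functional using (Vector; zipWith)
open import Data.Vec.Functional.Relation.Binary.Pointwise using (Pointwise)
open import Function.Definitions using (Injective)
open import Level using (0ℓ)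
open import Relation.Binary.Core using (Rel)
open import Relation.Binary.PropositionalEquality
  using (_≡_; refl; sym; trans; cong; subst)
open import Relation.Nullary.Negation using (¬_)
open import Relation.Unary using (Pred; _∈_)

------------------------------------------------------------------------
-- Real numbers: Cauchy sequences of rationals, where two sequences are
-- equal (≈) when their difference tends to 0. Taking _≈_ as the equality
-- replaces the quotient.

Cauchy : (ℕ → ℚ) → Set
Cauchy u = ∀ ε → 0ℚ ℚ.< ε →
  ∃ λ N → ∀ m n → N ℕ.≤ m → N ℕ.≤ n → ∣ u m ℚ.- u n ∣ ℚ.< ε

record ℝ : Set where
  constructor mkℝ
  field
    seq    : ℕ → ℚ
    cauchy : Cauchy seq

open ℝ public

infix 4 _≈_ _≤_

record _≈_ (x y : ℝ) : Set where
  constructor mk≈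
  field
    close : ∀ ε → 0ℚ ℚ.< ε →
      ∃ λ N → ∀ n → N ℕ.≤ n → ∣ seq x n ℚ.- seq y n ∣ ℚ.< ε

-- Dropping ε here would give a relation that does not respect _≈_.
record _≤_ (x y : ℝ) : Set where
  constructor mk≤
  field
    below : ∀ ε → 0ℚ ℚ.< ε →
      ∃ λ N → ∀ n → N ℕ.≤ n → seq x n ℚ.< seq y n ℚ.+ ε

open _≈_ public
open _≤_ public

private
  open import Algebra.Properties.CommutativeSemigroup
    (CommutativeMonoid.commutativeSemigroup ℚ.+-0-commutativeMonoid)
    using (interchange)

  abstract
    constant-cauchy : ∀ q → Cauchy (λ _ → q)
    constant-cauchy q ε 0<ε = 0 , λ _ _ _ _ →
      subst (λ z → ∣ z ∣ ℚ.< ε) (sym (ℚ.+-inverseʳ q)) 0<ε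

    neg-cauchy : ∀ {u} → Cauchy u → Cauchy (λ n → ℚ.- u n)
    neg-cauchy {u} cu ε 0<ε = let N , close = cu ε 0<ε in N , λ m n N≤m N≤n →
      subst (ℚ._< ε)
        (trans (sym (ℚ.∣-p∣≡∣p∣ (u m ℚ.- u n)))
               (cong ∣_∣ (ℚ.neg-distrib-+ (u m) (ℚ.- u n))))
        (close m n N≤m N≤n)

  ÷-pos : ∀ ε b → 0ℚ ℚ.< ε → 0ℚ ℚ.< b → ∃ λ δ → 0ℚ ℚ.< δ × b ℚ.* δ ≡ ε
  ÷-pos ε b 0<ε 0<b = δ , ℚ.positive⁻¹ δ , bδ≡ε
    where
    instance
      _ = ℚ.positive 0<ε
      _ = ℚ.positive 0<b
      _ = ℚ.pos⇒nonZero b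
      _ = ℚ.1/pos⇒pos b
    δ = (1/ b) ℚ.* ε
    instance
      _ = ℚ.pos*pos⇒pos (1/ b) ε
    bδ≡ε : b ℚ.* δ ≡ ε
    bδ≡ε = trans (sym (ℚ.*-assoc b (1/ b) ε))
             (trans (cong (ℚ._* ε) (ℚ.*-inverseʳ b)) (ℚ.*-identityˡ ε))

  halve : ∀ ε → 0ℚ ℚ.< ε → ∃ λ δ → 0ℚ ℚ.< δ × δ ℚ.+ δ ≡ ε
  halve ε 0<ε =
    let δ , 0<δ , 2δ≡ε = ÷-pos ε (1ℚ ℚ.+ 1ℚ) 0<ε (ℚ.positive⁻¹ (1ℚ ℚ.+ 1ℚ))
    in δ , 0<δ , trans (double δ) 2δ≡ε
    where
    double : ∀ d → d ℚ.+ d ≡ (1ℚ ℚ.+ 1ℚ) ℚ.* d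
    double = solve 1 (λ d → d :+ d := (con 1ℚ :+ con 1ℚ) :* d) refl
      where open +-*-Solver

  abstract
    +-cauchy : ∀ {u v} → Cauchy u → Cauchy v → Cauchy (λ n → u n ℚ.+ v n)
    +-cauchy {u} {v} cu cv ε 0<ε =
      let δ , 0<δ , δ+δ≡ε = halve ε 0<ε
          M , closeᵤ = cu δ 0<δ
          N , closeᵥ = cv δ 0<δ
      in M ⊔ N , λ m n ≤m ≤n → begin-strict
      ∣ (u m ℚ.+ v m) ℚ.- (u n ℚ.+ v n) ∣
        ≡⟨ cong ∣_∣ (regroup (u m) (v m) (u n) (v n)) ⟩
      ∣ (u m ℚ.- u n) ℚ.+ (v m ℚ.- v n) ∣
        ≤⟨ ℚ.∣p+q∣≤∣p∣+∣q∣ (u m ℚ.- u n) (v m ℚ.- v n) ⟩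
      ∣ u m ℚ.- u n ∣ ℚ.+ ∣ v m ℚ.- v n ∣
        <⟨ ℚ.+-mono-<
             (closeᵤ m n (ℕ.m⊔n≤o⇒m≤o M N ≤m) (ℕ.m⊔n≤o⇒m≤o M N ≤n))
             (closeᵥ m n (ℕ.m⊔n≤o⇒n≤o M N ≤m) (ℕ.m⊔n≤o⇒n≤o M N ≤n)) ⟩
      δ ℚ.+ δ
        ≡⟨ δ+δ≡ε ⟩
      ε ∎
      where
      open ℚ.≤-Reasoning
      regroup : ∀ a b c d →
        (a ℚ.+ b) ℚ.- (c ℚ.+ d) ≡ (a ℚ.- c) ℚ.+ (b ℚ.- d)
      regroup a b c d = trans (cong ((a ℚ.+ b) ℚ.+_) (ℚ.neg-distrib-+ c d))
                              (interchange a b (ℚ.- c) (ℚ.- d))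

  bounded : ∀ {u} → Cauchy u →
    ∃ λ b → 0ℚ ℚ.< b × ∃ λ N → ∀ n → N ℕ.≤ n → ∣ u n ∣ ℚ.≤ b
  bounded {u} cu = let N , close = cu 1ℚ (ℚ.positive⁻¹ 1ℚ) in
    1ℚ ℚ.+ ∣ u N ∣
    , ℚ.+-mono-<-≤ (ℚ.positive⁻¹ 1ℚ) (ℚ.0≤∣p∣ (u N))
    , N , λ n N≤n → begin
      ∣ u n ∣                        ≡⟨ cong ∣_∣ (split (u n) (u N)) ⟩
      ∣ (u n ℚ.- u N) ℚ.+ u N ∣      ≤⟨ ℚ.∣p+q∣≤∣p∣+∣q∣ (u n ℚ.- u N) (u N) ⟩
      ∣ u n ℚ.- u N ∣ ℚ.+ ∣ u N ∣    ≤⟨ ℚ.+-monoˡ-≤ ∣ u N ∣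
                                          (ℚ.<⇒≤ (close n N N≤n ℕ.≤-refl)) ⟩
      1ℚ ℚ.+ ∣ u N ∣                 ∎
    where
    open ℚ.≤-Reasoning
    split : ∀ a b → a ≡ (a ℚ.- b) ℚ.+ b
    split = solve 2 (λ a b → a := (a :- b) :+ b) refl
      where open +-*-Solver

  *-mono-bound : ∀ {p q b d} → ∣ p ∣ ℚ.≤ b → 0ℚ ℚ.< b → ∣ q ∣ ℚ.< d →
    ∣ p ℚ.* q ∣ ℚ.< b ℚ.* d
  *-mono-bound {p} {q} {b} {d} ∣p∣≤b 0<b ∣q∣<d = begin-strict
    ∣ p ℚ.* q ∣      ≡⟨ ℚ.∣p*q∣≡∣p∣*∣q∣ p q ⟩
    ∣ p ∣ ℚ.* ∣ q ∣  ≤⟨ ℚ.*-monoʳ-≤-nonNeg ∣ q ∣ ∣p∣≤b ⟩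
    b ℚ.* ∣ q ∣      <⟨ ℚ.*-monoʳ-<-pos b ∣q∣<d ⟩
    b ℚ.* d          ∎
    where
    open ℚ.≤-Reasoning
    instance
      _ = ℚ.nonNegative (ℚ.0≤∣p∣ q)
      _ = ℚ.positive 0<b

  abstract
    *-cauchy : ∀ {u v} → Cauchy u → Cauchy v → Cauchy (λ n → u n ℚ.* v n)
    *-cauchy {u} {v} cu cv ε 0<ε =
      let b , 0<b , M , u≤b = bounded cu
          c , 0<c , N , v≤c = bounded cv
          δ , 0<δ , [b+c]δ≡ε = ÷-pos ε (b ℚ.+ c) 0<ε (ℚ.+-mono-< 0<b 0<c)
          M′ , closeᵤ = cu δ 0<δ
          N′ , closeᵥ = cv δ 0<δ
          K = M ⊔ N
          K′ = M′ ⊔ N′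
      in K ⊔ K′ , λ m n ≤m ≤n →
      let K≤m  = ℕ.m⊔n≤o⇒m≤o K K′ ≤m
          K≤n  = ℕ.m⊔n≤o⇒m≤o K K′ ≤n
          K′≤m = ℕ.m⊔n≤o⇒n≤o K K′ ≤m
          K′≤n = ℕ.m⊔n≤o⇒n≤o K K′ ≤n
      in begin-strict
      ∣ u m ℚ.* v m ℚ.- u n ℚ.* v n ∣
        ≡⟨ cong ∣_∣ (telescope (u m) (v m) (u n) (v n)) ⟩
      ∣ u m ℚ.* (v m ℚ.- v n) ℚ.+ v n ℚ.* (u m ℚ.- u n) ∣
        ≤⟨ ℚ.∣p+q∣≤∣p∣+∣q∣ (u m ℚ.* (v m ℚ.- v n)) (v n ℚ.* (u m ℚ.- u n)) ⟩
      ∣ u m ℚ.* (v m ℚ.- v n) ∣ ℚ.+ ∣ v n ℚ.* (u m ℚ.- u n) ∣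
        <⟨ ℚ.+-mono-<
             (*-mono-bound {u m} {v m ℚ.- v n} (u≤b m (ℕ.m⊔n≤o⇒m≤o M N K≤m)) 0<b
               (closeᵥ m n (ℕ.m⊔n≤o⇒n≤o M′ N′ K′≤m) (ℕ.m⊔n≤o⇒n≤o M′ N′ K′≤n)))
             (*-mono-bound {v n} {u m ℚ.- u n} (v≤c n (ℕ.m⊔n≤o⇒n≤o M N K≤n)) 0<c
               (closeᵤ m n (ℕ.m⊔n≤o⇒m≤o M′ N′ K′≤m) (ℕ.m⊔n≤o⇒m≤o M′ N′ K′≤n))) ⟩
      b ℚ.* δ ℚ.+ c ℚ.* δ
        ≡⟨ sym (ℚ.*-distribʳ-+ δ b c) ⟩
      (b ℚ.+ c) ℚ.* δ
        ≡⟨ [b+c]δ≡ε ⟩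
      ε ∎
      where
      open ℚ.≤-Reasoning
      telescope : ∀ a b c d →
        a ℚ.* b ℚ.- c ℚ.* d ≡ a ℚ.* (b ℚ.- d) ℚ.+ d ℚ.* (a ℚ.- c)
      telescope = solve 4
        (λ a b c d → a :* b :- c :* d := a :* (b :- d) :+ d :* (a :- c)) refl
        where open +-*-Solver

infix  8 -_
infixl 7 _*_
infixl 6 _+_ _-_

0ℝ 1ℝ : ℝ
0ℝ = mkℝ (λ _ → 0ℚ) (constant-cauchy 0ℚ)
1ℝ = mkℝ (λ _ → 1ℚ) (constant-cauchy 1ℚ)

-_ : ℝ → ℝ
- x = mkℝ (λ n → ℚ.- seq x n) (neg-cauchy {seq x} (cauchy x))

_+_ _*_ _-_ : ℝ → ℝ → ℝ
x + y = mkℝ (λ n → seq x n ℚ.+ seq y n)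
            (+-cauchy {seq x} {seq y} (cauchy x) (cauchy y))
x * y = mkℝ (λ n → seq x n ℚ.* seq y n)
            (*-cauchy {seq x} {seq y} (cauchy x) (cauchy y))
x - y = x + (- y)

+-0-rawMonoid : RawMonoid 0ℓ 0ℓ
+-0-rawMonoid = record { Carrier = ℝ ; _≈_ = _≈_ ; _∙_ = _+_ ; ε = 0ℝ }

open RawMonoidSum +-0-rawMonoid public using (sum)

------------------------------------------------------------------------

infix 9 ℝ^_

ℝ^_ : ℕ → Set
ℝ^ n = Vector ℝ n

infix  4 _≈ᵛ_
infixl 6 _-ᵛ_

_≈ᵛ_ : ∀ {n} → Rel (ℝ^ n) 0ℓ
_≈ᵛ_ = Pointwise _≈_

_-ᵛ_ : ∀ {n} → ℝ^ n → ℝ^ n → ℝ^ n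
_-ᵛ_ = zipWith _-_

⟨_,_⟩ : ∀ {n} → ℝ^ n → ℝ^ n → ℝ
⟨ x , y ⟩ = sum (zipWith _*_ x y)

-- ‖ x ‖≈ r says that r is the Euclidean norm of x, i.e. the nonnegative
-- square root of ⟨ x , x ⟩; given as a relation to avoid constructing
-- the square root function.
infix 4 ‖_‖≈_

‖_‖≈_ : ∀ {n} → ℝ^ n → ℝ → Set
‖ x ‖≈ r = 0ℝ ≤ r × r * r ≈ ⟨ x , x ⟩

UnitSphere : ∀ {n} → Pred (ℝ^ n) 0ℓ
UnitSphere x = ‖ x ‖≈ 1ℝ

------------------------------------------------------------------------
-- Finite sets. A subset of a type with equality _~_ is a predicate, and
-- its elements are counted up to _~_.

module _ {A : Set} (_~_ : Rel A 0ℓ) where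

  -- S = {e₁,…,e_k} with the e_i pairwise distinct.
  Enumerates : ∀ {k} → (Fin k → A) → Pred A 0ℓ → Set
  Enumerates e S =
    (∀ i → e i ∈ S) × Injective _≡_ _~_ e × (∀ x → x ∈ S → ∃ λ i → x ~ e i)

  HasCardinality : Pred A 0ℓ → ℕ → Set
  HasCardinality S k = Σ (Fin k → A) λ e → Enumerates e S

  Finite : Pred A 0ℓ → Set
  Finite S = ∃ λ k → HasCardinality S k

------------------------------------------------------------------------

module _ {n : ℕ} (F : Pred (ℝ^ n) 0ℓ) where

  Distances : Pred ℝ 0ℓ
  Distances r = ∃₂ λ x y → x ∈ F × y ∈ F × ¬ (x ≈ᵛ y) × ‖ x -ᵛ y ‖≈ r

  InnerProducts : Pred ℝ 0ℓ
  InnerProducts t = ∃₂ λ x y → x ∈ F × y ∈ F × ¬ (x ≈ᵛ y) × ⟨ x , y ⟩ ≈ t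

  IsDistanceSet : ℕ → Set
  IsDistanceSet s = Finite _≈ᵛ_ F × HasCardinality _≈_ Distances s

  IsSphericalDistanceSet : ℕ → Set
  IsSphericalDistanceSet s = IsDistanceSet s × (∀ x → x ∈ F → x ∈ UnitSphere)

------------------------------------------------------------------------

infixl 6.5 _Cᶻ_

_Cᶻ_ : ℕ → ℤ → ℕ
a Cᶻ (+ b)    = a C b
a Cᶻ -[1+ _ ] = 0

-- To a point x of F attach f_x(y) = ∏ (⟨x,y⟩ - t_l). On F it vanishes exactly
-- off x, so these functions are linearly independent. Since t_1 + … + t_s = 0,
-- the expansion of f_x in powers of ⟨x,y⟩ has no term of degree s - 1, and as
-- ‖y‖ = 1 on the sphere, the remaining terms can be homogenised to degree s or
-- s - 3 according to their parity. Hence all f_x lie in a space spanned by the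
-- monomials of these two degrees. Equality of reals is not decidable, but it is
-- stable under double negation, and so is the conclusion, which suffices for
-- the case distinctions of linear algebra.

module Submission where

open import Defs
open import Algebra.Bundles using (CommutativeRing; Semiring)
import Algebra.Definitions.RawSemiring as RawSemiringDefinitions
import Algebra.Properties.CommutativeSemigroup as CommutativeSemigroupProperties
import Algebra.Properties.Group as GroupProperties
import Algebra.Properties.Semiring.Sum as SemiringSum
open import Data.Fin.Base using (Fin; zero; suc; punchIn)
import Data.Fin.Properties as Fin
open import Data.Integer.Base using (_⊖_)
open import Data.List.Base using (List; []; _∷_; _++_; map; length; applyDownFrom)
open import Data.List.Membership.Propositional using (_∈_)
open import Data.List.Membership.Propositional.Properties
  using (∈-map⁺; ∈-map⁻; ∈-++⁺ˡ; ∈-++⁺ʳ; ∈-++⁻; ∈-applyDownFrom⁺; ∈-applyDownFrom⁻)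
open import Data.List.Properties using (length-++; length-map)
open import Data.List.Relation.Unary.Any using (here; there)
open import Data.Nat.Base as ℕ using (ℕ; zero; suc; NonZero; _∸_; _⊔_; s≤s; z≤n)
open import Data.Nat.Combinatorics
  using (_C_; k>n⇒nCk≡0; nCk+nC[k+1]≡[n+1]C[k+1])
import Data.Nat.Properties as ℕ
open import Data.Product.Base using (∃; ∃₂; _×_; _,_; proj₁; proj₂)
open import Data.Rational.Base as ℚ using (ℚ; 0ℚ; 1ℚ; ½; ∣_∣; 1/_)
import Data.Rational.Properties as ℚ
open import Data.Rational.Solver using (module +-*-Solver)
open import Data.Sum.Base using (inj₁; inj₂)
open import Function.Base using (_∘_; id; flip)
open import Level using (0ℓ)
open import Relation.Binary.PropositionalEquality as ≡
  using (_≡_; _≢_; refl; cong; cong₂; subst; subst₂)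
open import Relation.Nullary.Decidable using (decidable-stable)
open import Relation.Nullary.Negation using (¬_; contradiction)
open import Relation.Unary using (Pred)

open +-*-Solver using (solve; con; _:=_; _:+_; _:*_; _:-_; :-_)

-- Real numbers

0<p*q : ∀ {p q} → 0ℚ ℚ.< p → 0ℚ ℚ.< q → 0ℚ ℚ.< p ℚ.* q
0<p*q {p} {q} 0<p 0<q = ℚ.positive⁻¹ (p ℚ.* q)
  where instance
    _ = ℚ.positive 0<p
    _ = ℚ.positive 0<q
    _ = ℚ.pos*pos⇒pos p q

0<½*p : ∀ {p} → 0ℚ ℚ.< p → 0ℚ ℚ.< ½ ℚ.* p
0<½*p = 0<p*q (ℚ.positive⁻¹ ½)

½*p+½*p≡p : ∀ p → ½ ℚ.* p ℚ.+ ½ ℚ.* p ≡ p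
½*p+½*p≡p = solve 1 (λ p → con ½ :* p :+ con ½ :* p := p) refl

∣p-r∣≤∣p-q∣+∣q-r∣ : ∀ p q r → ∣ p ℚ.- r ∣ ℚ.≤ ∣ p ℚ.- q ∣ ℚ.+ ∣ q ℚ.- r ∣
∣p-r∣≤∣p-q∣+∣q-r∣ p q r = subst (λ d → ∣ d ∣ ℚ.≤ ∣ p ℚ.- q ∣ ℚ.+ ∣ q ℚ.- r ∣) (split p q r)
  (ℚ.∣p+q∣≤∣p∣+∣q∣ (p ℚ.- q) (q ℚ.- r))
  where
  split : ∀ p q r → (p ℚ.- q) ℚ.+ (q ℚ.- r) ≡ p ℚ.- r
  split = solve 3 (λ p q r → (p :- q) :+ (q :- r) := p :- r) refl

∣p-q∣≡∣q-p∣ : ∀ p q → ∣ p ℚ.- q ∣ ≡ ∣ q ℚ.- p ∣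
∣p-q∣≡∣q-p∣ p q = ≡.trans (cong ∣_∣ (swap p q)) (ℚ.∣-p∣≡∣p∣ (q ℚ.- p))
  where
  swap : ∀ p q → p ℚ.- q ≡ ℚ.- (q ℚ.- p)
  swap = solve 2 (λ p q → p :- q := :- (q :- p)) refl

*-mono-≤-nonNeg : ∀ {p q r s} → 0ℚ ℚ.≤ r → 0ℚ ℚ.≤ q →
  p ℚ.≤ q → r ℚ.≤ s → p ℚ.* r ℚ.≤ q ℚ.* s
*-mono-≤-nonNeg {p} {q} {r} {s} 0≤r 0≤q p≤q r≤s =
  ℚ.≤-trans (ℚ.*-monoʳ-≤-nonNeg r p≤q) (ℚ.*-monoˡ-≤-nonNeg q r≤s)
  where instance
    _ = ℚ.nonNegative 0≤r
    _ = ℚ.nonNegative 0≤q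

-- The operations act term by term, so this reduces every ring identity for reals to one for
-- rationals, where the solver applies.
≗⇒≈ : ∀ {x y} → (∀ n → seq x n ≡ seq y n) → x ≈ y
≗⇒≈ {x} {y} x≗y = mk≈ λ ε 0<ε → 0 , λ n _ →
  subst (λ d → ∣ d ∣ ℚ.< ε) (≡.sym (x-y≡0 n)) 0<ε
  where
  x-y≡0 : ∀ n → seq x n ℚ.- seq y n ≡ 0ℚ
  x-y≡0 n = ≡.trans (cong (ℚ._- seq y n) (x≗y n)) (ℚ.+-inverseʳ (seq y n))

≈-refl : ∀ {x} → x ≈ x
≈-refl = ≗⇒≈ λ _ → refl

≈-sym : ∀ {x y} → x ≈ y → y ≈ x
≈-sym {x} {y} x≈y = mk≈ λ ε 0<ε → let N , x-y<ε = close x≈y ε 0<ε in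
  N , λ n N≤n → subst (ℚ._< ε) (∣p-q∣≡∣q-p∣ (seq x n) (seq y n)) (x-y<ε n N≤n)

≈-trans : ∀ {x y z} → x ≈ y → y ≈ z → x ≈ z
≈-trans {x} {y} {z} x≈y y≈z = mk≈ λ ε 0<ε →
  let M , x-y<δ = close x≈y (½ ℚ.* ε) (0<½*p 0<ε)
      N , y-z<δ = close y≈z (½ ℚ.* ε) (0<½*p 0<ε)
  in M ⊔ N , λ n ≤n → begin-strict
    ∣ seq x n ℚ.- seq z n ∣
      ≤⟨ ∣p-r∣≤∣p-q∣+∣q-r∣ (seq x n) (seq y n) (seq z n) ⟩
    ∣ seq x n ℚ.- seq y n ∣ ℚ.+ ∣ seq y n ℚ.- seq z n ∣
      <⟨ ℚ.+-mono-< (x-y<δ n (ℕ.m⊔n≤o⇒m≤o M N ≤n))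
                    (y-z<δ n (ℕ.m⊔n≤o⇒n≤o M N ≤n)) ⟩
    ½ ℚ.* ε ℚ.+ ½ ℚ.* ε
      ≡⟨ ½*p+½*p≡p ε ⟩
    ε ∎
  where open ℚ.≤-Reasoning

+-cong : ∀ {x y u v} → x ≈ y → u ≈ v → x + u ≈ y + v
+-cong {x} {y} {u} {v} x≈y u≈v = mk≈ λ ε 0<ε →
  let M , x-y<δ = close x≈y (½ ℚ.* ε) (0<½*p 0<ε)
      N , u-v<δ = close u≈v (½ ℚ.* ε) (0<½*p 0<ε)
  in M ⊔ N , λ n ≤n → begin-strict
    ∣ (seq x n ℚ.+ seq u n) ℚ.- (seq y n ℚ.+ seq v n) ∣
      ≡⟨ cong ∣_∣ (regroup (seq x n) (seq u n) (seq y n) (seq v n)) ⟩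
    ∣ (seq x n ℚ.- seq y n) ℚ.+ (seq u n ℚ.- seq v n) ∣
      ≤⟨ ℚ.∣p+q∣≤∣p∣+∣q∣ (seq x n ℚ.- seq y n) (seq u n ℚ.- seq v n) ⟩
    ∣ seq x n ℚ.- seq y n ∣ ℚ.+ ∣ seq u n ℚ.- seq v n ∣
      <⟨ ℚ.+-mono-< (x-y<δ n (ℕ.m⊔n≤o⇒m≤o M N ≤n))
                    (u-v<δ n (ℕ.m⊔n≤o⇒n≤o M N ≤n)) ⟩
    ½ ℚ.* ε ℚ.+ ½ ℚ.* ε
      ≡⟨ ½*p+½*p≡p ε ⟩
    ε ∎
  where
  open ℚ.≤-Reasoning
  regroup : ∀ p q r s → (p ℚ.+ q) ℚ.- (r ℚ.+ s) ≡ (p ℚ.- r) ℚ.+ (q ℚ.- s)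
  regroup = solve 4 (λ p q r s → (p :+ q) :- (r :+ s) := (p :- r) :+ (q :- s)) refl

eventually-bounded : ∀ x → ∃₂ λ b N → 0ℚ ℚ.< b × ∀ n → N ℕ.≤ n → ∣ seq x n ∣ ℚ.≤ b
eventually-bounded x =
  let N , near = cauchy x 1ℚ (ℚ.positive⁻¹ 1ℚ) in
  -- The summand `ℚ.- 0ℚ` puts the bound in the form given by the three-point triangle inequality
  -- with third point 0.
  1ℚ ℚ.+ ∣ seq x N ℚ.- 0ℚ ∣ , N ,
  ℚ.+-mono-<-≤ (ℚ.positive⁻¹ 1ℚ) (ℚ.0≤∣p∣ (seq x N ℚ.- 0ℚ)) ,
  λ n N≤n → begin
    ∣ seq x n ∣                                     ≡⟨ cong ∣_∣ (ℚ.+-identityʳ (seq x n)) ⟨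
    ∣ seq x n ℚ.- 0ℚ ∣                              ≤⟨ ∣p-r∣≤∣p-q∣+∣q-r∣ (seq x n) (seq x N) 0ℚ ⟩
    ∣ seq x n ℚ.- seq x N ∣ ℚ.+ ∣ seq x N ℚ.- 0ℚ ∣  ≤⟨ ℚ.+-monoˡ-≤ _ (ℚ.<⇒≤ (near n N N≤n ℕ.≤-refl)) ⟩
    1ℚ ℚ.+ ∣ seq x N ℚ.- 0ℚ ∣                       ∎
  where open ℚ.≤-Reasoning

*-congˡ : ∀ x {y z} → y ≈ z → x * y ≈ x * z
*-congˡ x {y} {z} y≈z = mk≈ λ ε 0<ε →
  let b , M , 0<b , x≤b = eventually-bounded x
      instance
        _ = ℚ.positive 0<b
        _ = ℚ.pos⇒nonZero b
        _ = ℚ.1/pos⇒pos b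
      δ = (1/ b) ℚ.* ε
      N , y-z<δ = close y≈z δ (0<p*q (ℚ.positive⁻¹ (1/ b)) 0<ε)
  in M ⊔ N , λ n ≤n →
    let instance _ = ℚ.nonNegative (ℚ.0≤∣p∣ (seq y n ℚ.- seq z n)) in begin-strict
    ∣ seq x n ℚ.* seq y n ℚ.- seq x n ℚ.* seq z n ∣
      ≡⟨ cong ∣_∣ (factor (seq x n) (seq y n) (seq z n)) ⟩
    ∣ seq x n ℚ.* (seq y n ℚ.- seq z n) ∣
      ≡⟨ ℚ.∣p*q∣≡∣p∣*∣q∣ (seq x n) (seq y n ℚ.- seq z n) ⟩
    ∣ seq x n ∣ ℚ.* ∣ seq y n ℚ.- seq z n ∣
      ≤⟨ ℚ.*-monoʳ-≤-nonNeg ∣ seq y n ℚ.- seq z n ∣ (x≤b n (ℕ.m⊔n≤o⇒m≤o M N ≤n)) ⟩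
    b ℚ.* ∣ seq y n ℚ.- seq z n ∣
      <⟨ ℚ.*-monoʳ-<-pos b (y-z<δ n (ℕ.m⊔n≤o⇒n≤o M N ≤n)) ⟩
    b ℚ.* ((1/ b) ℚ.* ε)
      ≡⟨ ℚ.*-assoc b (1/ b) ε ⟨
    b ℚ.* (1/ b) ℚ.* ε
      ≡⟨ cong (ℚ._* ε) (ℚ.*-inverseʳ b) ⟩
    1ℚ ℚ.* ε
      ≡⟨ ℚ.*-identityˡ ε ⟩
    ε ∎
  where
  open ℚ.≤-Reasoning
  factor : ∀ p q r → p ℚ.* q ℚ.- p ℚ.* r ≡ p ℚ.* (q ℚ.- r)
  factor = solve 3 (λ p q r → p :* q :- p :* r := p :* (q :- r)) refl

*-comm : ∀ x y → x * y ≈ y * x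
*-comm x y = ≗⇒≈ λ n → ℚ.*-comm (seq x n) (seq y n)

*-cong : ∀ {x y u v} → x ≈ y → u ≈ v → x * u ≈ y * v
*-cong {x} {y} {u} {v} x≈y u≈v = ≈-trans (*-congˡ x u≈v)
  (≈-trans (*-comm x v) (≈-trans (*-congˡ v x≈y) (*-comm v y)))

-‿cong : ∀ {x y} → x ≈ y → - x ≈ - y
-‿cong {x} {y} x≈y = mk≈ λ ε 0<ε → let N , x-y<ε = close x≈y ε 0<ε in
  N , λ n N≤n → subst (ℚ._< ε)
    (≡.trans (∣p-q∣≡∣q-p∣ (seq x n) (seq y n)) (cong ∣_∣ (swap (seq x n) (seq y n))))
    (x-y<ε n N≤n)
  where
  swap : ∀ p q → q ℚ.- p ≡ (ℚ.- p) ℚ.- (ℚ.- q)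
  swap = solve 2 (λ p q → q :- p := (:- p) :- (:- q)) refl

ℝ-commutativeRing : CommutativeRing 0ℓ 0ℓ
ℝ-commutativeRing = record
  { Carrier = ℝ ; _≈_ = _≈_ ; _+_ = _+_ ; _*_ = _*_ ; -_ = -_ ; 0# = 0ℝ ; 1# = 1ℝ
  ; isCommutativeRing = record
    { isRing = record
      { +-isAbelianGroup = record
        { isGroup = record
          { isMonoid = record
            { isSemigroup = record
              { isMagma = record
                { isEquivalence = record { refl = ≈-refl ; sym = ≈-sym ; trans = ≈-trans }
                ; ∙-cong = +-cong
                }
              ; assoc = λ x y z → ≗⇒≈ λ n → ℚ.+-assoc (seq x n) (seq y n) (seq z n)
              }
            ; identity = (λ x → ≗⇒≈ λ n → ℚ.+-identityˡ (seq x n))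
                       , (λ x → ≗⇒≈ λ n → ℚ.+-identityʳ (seq x n))
            }
          ; inverse = (λ x → ≗⇒≈ λ n → ℚ.+-inverseˡ (seq x n))
                    , (λ x → ≗⇒≈ λ n → ℚ.+-inverseʳ (seq x n))
          ; ⁻¹-cong = -‿cong
          }
        ; comm = λ x y → ≗⇒≈ λ n → ℚ.+-comm (seq x n) (seq y n)
        }
      ; *-cong = *-cong
      ; *-assoc = λ x y z → ≗⇒≈ λ n → ℚ.*-assoc (seq x n) (seq y n) (seq z n)
      ; *-identity = (λ x → ≗⇒≈ λ n → ℚ.*-identityˡ (seq x n))
                   , (λ x → ≗⇒≈ λ n → ℚ.*-identityʳ (seq x n))
      ; distrib = (λ x y z → ≗⇒≈ λ n → ℚ.*-distribˡ-+ (seq x n) (seq y n) (seq z n))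
                , (λ x y z → ≗⇒≈ λ n → ℚ.*-distribʳ-+ (seq x n) (seq y n) (seq z n))
      }
    ; *-comm = *-comm
    }
  }

private module R = CommutativeRing ℝ-commutativeRing

open RawSemiringDefinitions (Semiring.rawSemiring R.semiring)
  using (_^_; product)
open SemiringSum R.semiring using (*-distribʳ-sum) renaming (sum-cong-≋ to sum-cong)
open import Relation.Binary.Reasoning.Setoid R.setoid

-- Apartness from zero and double-negation stability

-- The positive form of being nonzero: it carries a rational lower bound, which cancellation needs
-- and `¬ x ≈ 0ℝ` does not supply.
_#0 : ℝ → Set
x #0 = ∃₂ λ δ N → 0ℚ ℚ.< δ × ∀ n → N ℕ.≤ n → δ ℚ.≤ ∣ seq x n ∣

close-0 : ∀ {x} → x ≈ 0ℝ → ∀ ε → 0ℚ ℚ.< ε → ∃ λ N → ∀ n → N ℕ.≤ n → ∣ seq x n ∣ ℚ.< ε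
close-0 {x} x≈0 ε 0<ε = let N , x<ε = close x≈0 ε 0<ε in
  N , λ n N≤n → subst (λ p → ∣ p ∣ ℚ.< ε) (ℚ.+-identityʳ (seq x n)) (x<ε n N≤n)

mk≈0 : ∀ {x} → (∀ ε → 0ℚ ℚ.< ε → ∃ λ N → ∀ n → N ℕ.≤ n → ∣ seq x n ∣ ℚ.< ε) → x ≈ 0ℝ
mk≈0 {x} small = mk≈ λ ε 0<ε → let N , x<ε = small ε 0<ε in
  N , λ n N≤n → subst (λ p → ∣ p ∣ ℚ.< ε) (≡.sym (ℚ.+-identityʳ (seq x n))) (x<ε n N≤n)

-- A late term of absolute value at least ε would, by the Cauchy condition for ε/2, keep all late
-- terms at least ε/2 away from 0. Comparison of rationals is decidable, so each term may be treated
-- by contradiction.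
¬#0⇒≈0 : ∀ {x} → ¬ (x #0) → x ≈ 0ℝ
¬#0⇒≈0 {x} ¬x#0 = mk≈0 λ ε 0<ε →
  let N , near = cauchy x (½ ℚ.* ε) (0<½*p 0<ε) in
  N , λ n N≤n → decidable-stable (∣ seq x n ∣ ℚ.<? ε) λ x≮ε →
    ¬x#0 (½ ℚ.* ε , N , 0<½*p 0<ε , λ k N≤k → ℚ.≮⇒≥ λ x<½ε →
      x≮ε (ℚ.≤-<-trans (bound n k)
        (subst (_ ℚ.<_) (½*p+½*p≡p ε) (ℚ.+-mono-< (near n k N≤n N≤k) x<½ε))))
  where
  bound : ∀ n k → ∣ seq x n ∣ ℚ.≤ ∣ seq x n ℚ.- seq x k ∣ ℚ.+ ∣ seq x k ∣
  bound n k = subst₂ (λ p q → ∣ p ∣ ℚ.≤ ∣ seq x n ℚ.- seq x k ∣ ℚ.+ ∣ q ∣)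
    (ℚ.+-identityʳ (seq x n)) (ℚ.+-identityʳ (seq x k))
    (∣p-r∣≤∣p-q∣+∣q-r∣ (seq x n) (seq x k) 0ℚ)

#0⇒≉0 : ∀ {x} → x #0 → ¬ x ≈ 0ℝ
#0⇒≉0 (δ , M , 0<δ , δ≤x) x≈0 = let N , x<δ = close-0 x≈0 δ 0<δ in
  ℚ.<-irrefl refl (ℚ.≤-<-trans (δ≤x (M ⊔ N) (ℕ.m≤m⊔n M N)) (x<δ (M ⊔ N) (ℕ.m≤n⊔m M N)))

-- Being zero is equivalent to the negation of `_#0`, and negations are stable.
≈0-stable : ∀ {x} → ¬ ¬ x ≈ 0ℝ → x ≈ 0ℝ
≈0-stable ¬¬x≈0 = ¬#0⇒≈0 λ x#0 → ¬¬x≈0 (#0⇒≉0 x#0)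

#0-cancel : ∀ {x y} → x #0 → x * y ≈ 0ℝ → y ≈ 0ℝ
#0-cancel {x} {y} (δ , M , 0<δ , δ≤x) xy≈0 = mk≈0 λ ε 0<ε →
  let N , xy<δε = close-0 xy≈0 (δ ℚ.* ε) (0<p*q 0<δ 0<ε) in
  M ⊔ N , λ n ≤n → decidable-stable (∣ seq y n ∣ ℚ.<? ε) λ y≮ε →
    ℚ.<-irrefl refl (ℚ.≤-<-trans
      (*-mono-≤-nonNeg (ℚ.<⇒≤ 0<ε) (ℚ.0≤∣p∣ (seq x n))
        (δ≤x n (ℕ.m⊔n≤o⇒m≤o M N ≤n)) (ℚ.≮⇒≥ y≮ε))
      (subst (ℚ._< δ ℚ.* ε) (ℚ.∣p*q∣≡∣p∣*∣q∣ (seq x n) (seq y n))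
        (xy<δε n (ℕ.m⊔n≤o⇒n≤o M N ≤n))))

-- From `¬ x ≈ 0ℝ` one obtains `x #0` only up to double negation, which the stable conclusion
-- absorbs.
*-cancel-≉0 : ∀ {x y} → ¬ x ≈ 0ℝ → x * y ≈ 0ℝ → y ≈ 0ℝ
*-cancel-≉0 x≉0 xy≈0 = ≈0-stable λ y≉0 → x≉0 (¬#0⇒≈0 λ x#0 → y≉0 (#0-cancel x#0 xy≈0))

x*x≈0⇒x≈0 : ∀ {x} → x * x ≈ 0ℝ → x ≈ 0ℝ
x*x≈0⇒x≈0 xx≈0 = ≈0-stable λ x≉0 → x≉0 (*-cancel-≉0 x≉0 xx≈0)

x-y≈0⇒x≈y : ∀ {x y} → x - y ≈ 0ℝ → x ≈ y
x-y≈0⇒x≈y {x} {y} = GroupProperties.x∙y⁻¹≈ε⇒x≈y R.+-group x y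

-- Spans of finitely many functions

private variable
  Y : Set
  g : Y → ℝ
  ws vs : List (Y → ℝ)

infixr 7 _·_

_·_ : (Y → ℝ) → (Y → ℝ) → Y → ℝ
(f · g) y = f y * g y

-- Generating the span inductively avoids coefficient vectors; `resp` closes it under pointwise
-- equality of reals.
data Span {Y : Set} (ws : List (Y → ℝ)) : Pred (Y → ℝ) 0ℓ where
  gen   : ∀ {w} → w ∈ ws → Span ws w
  zero  : Span ws λ _ → 0ℝ
  add   : ∀ {g h} → Span ws g → Span ws h → Span ws λ y → g y + h y
  scale : ∀ c {g} → Span ws g → Span ws λ y → c * g y
  resp  : ∀ {g h} → (∀ y → g y ≈ h y) → Span ws g → Span ws h

-- Multiplication by `f` is linear, so generators suffice.
span-· : (f : Y → ℝ) → (∀ {w} → w ∈ ws → Span vs (f · w)) → Span ws g → Span vs (f · g)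
span-· f f·w (gen w∈)    = f·w w∈
span-· f f·w zero        = resp (λ y → R.sym (R.zeroʳ (f y))) zero
span-· f f·w (add {g} {h} p q) =
  resp (λ y → R.sym (R.distribˡ (f y) (g y) (h y))) (add (span-· f f·w p) (span-· f f·w q))
span-· f f·w (scale c {g} p) =
  resp (λ y → x∙yz≈y∙xz c (f y) (g y)) (scale c (span-· f f·w p))
  where open CommutativeSemigroupProperties R.*-commutativeSemigroup using (x∙yz≈y∙xz)
span-· f f·w (resp g≈h p) = resp (λ y → R.*-congˡ (g≈h y)) (span-· f f·w p)

-- This is the case of multiplication by the constant 1.
span-trans : (∀ {w} → w ∈ ws → Span vs w) → Span ws g → Span vs g
span-trans ws⊆ p = resp (λ y → R.*-identityˡ _) (span-· (λ _ → 1ℝ)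
  (λ w∈ → resp (λ y → R.sym (R.*-identityˡ _)) (ws⊆ w∈)) p)

span-++ˡ : Span ws g → Span (ws ++ vs) g
span-++ˡ = span-trans (gen ∘ ∈-++⁺ˡ)

span-++ʳ : Span vs g → Span (ws ++ vs) g
span-++ʳ {ws = ws} = span-trans (gen ∘ ∈-++⁺ʳ ws)

span-sum : ∀ {n} (u : Fin n → Y → ℝ) → (∀ i → Span ws (u i)) →
  Span ws λ y → sum (λ i → u i y)
span-sum {n = zero}  u p = zero
span-sum {n = suc n} u p = add (p zero) (span-sum (u ∘ suc) (p ∘ suc))

span-[] : Span [] g → ∀ y → g y ≈ 0ℝ
span-[] zero          y = R.refl
span-[] (add p q)     y = R.trans (R.+-cong (span-[] p y) (span-[] q y)) (R.+-identityˡ 0ℝ)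
span-[] (scale c p)   y = R.trans (R.*-congˡ (span-[] p y)) (R.zeroʳ c)
span-[] (resp g≈h p)  y = R.trans (R.sym (g≈h y)) (span-[] p y)

-- Splits off the first generator for elimination. The coefficient is read off the derivation and
-- need not be unique.
span-∷ : ∀ {w} → Span (w ∷ ws) g →
  ∃₂ λ c h → Span ws h × ∀ y → g y ≈ c * w y + h y
span-∷ (gen (here refl)) =
  1ℝ , _ , zero , λ y → R.sym (R.trans (R.+-identityʳ _) (R.*-identityˡ _))
span-∷ (gen (there w∈)) =
  0ℝ , _ , gen w∈ , λ y → R.sym (R.trans (R.+-congʳ (R.zeroˡ _)) (R.+-identityˡ _))
span-∷ zero =
  0ℝ , _ , zero , λ y → R.sym (R.trans (R.+-congʳ (R.zeroˡ _)) (R.+-identityˡ _))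
span-∷ {w = w} (add p q) =
  let c , g′ , p′ , g≈ = span-∷ p
      d , h′ , q′ , h≈ = span-∷ q
  in c + d , _ , add p′ q′ , λ y →
    R.trans (R.+-cong (g≈ y) (h≈ y)) (collect c (w y) (g′ y) d (h′ y))
  where
  collect : ∀ c w g d h → (c * w + g) + (d * w + h) ≈ (c + d) * w + (g + h)
  collect c w g d h = ≗⇒≈ λ n → solve 5
    (λ c w g d h → (c :* w :+ g) :+ (d :* w :+ h) := (c :+ d) :* w :+ (g :+ h)) refl
    (seq c n) (seq w n) (seq g n) (seq d n) (seq h n)
span-∷ {w = w} (scale a p) =
  let c , g′ , p′ , g≈ = span-∷ p
  in a * c , _ , scale a p′ , λ y →
    R.trans (R.*-congˡ (g≈ y)) (R.trans (R.distribˡ a _ _) (R.+-congʳ (R.sym (R.*-assoc a c _))))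
span-∷ (resp g≈h p) =
  let c , g′ , p′ , g≈ = span-∷ p in c , g′ , p′ , λ y → R.trans (R.sym (g≈h y)) (g≈ y)

-- Gaussian elimination: subtracting multiples of the pivot function f p
-- keeps the matrix f i (x j) diagonal off the pivot, because f p vanishes
-- at the other points.
diagonal⇒≤length : ∀ (ws : List (Y → ℝ)) {m} (x : Fin m → Y) (f : Fin m → Y → ℝ) →
  (∀ i → ¬ f i (x i) ≈ 0ℝ) → (∀ i j → i ≢ j → f i (x j) ≈ 0ℝ) →
  (∀ i → Span ws (f i)) → m ℕ.≤ length ws
diagonal⇒≤length ws {zero} x f diag off f∈ = z≤n
diagonal⇒≤length [] {suc m} x f diag off f∈ =
  contradiction (span-[] (f∈ zero) (x zero)) (diag zero)
diagonal⇒≤length {Y} (w ∷ ws) {suc m} x f diag off f∈ =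
  decidable-stable (suc m ℕ.≤? suc (length ws)) λ m≰ →
    m≰ (ℕ.m≤n⇒m≤1+n (diagonal⇒≤length ws x f diag off
      (λ i → without-w i (≈0-stable λ cᵢ≉0 → m≰ (s≤s (eliminate i cᵢ≉0))))))
  where
  c : Fin (suc m) → ℝ
  c i = proj₁ (span-∷ (f∈ i))
  r : Fin (suc m) → Y → ℝ
  r i = proj₁ (proj₂ (span-∷ (f∈ i)))
  r∈ : ∀ i → Span ws (r i)
  r∈ i = proj₁ (proj₂ (proj₂ (span-∷ (f∈ i))))
  f≈ : ∀ i y → f i y ≈ c i * w y + r i y
  f≈ i = proj₂ (proj₂ (proj₂ (span-∷ (f∈ i))))

  without-w : ∀ i → c i ≈ 0ℝ → Span ws (f i)
  without-w i cᵢ≈0 = resp (λ y → R.sym (begin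
    f i y               ≈⟨ f≈ i y ⟩
    c i * w y + r i y   ≈⟨ R.+-congʳ (R.trans (R.*-congʳ cᵢ≈0) (R.zeroˡ (w y))) ⟩
    0ℝ + r i y          ≈⟨ R.+-identityˡ (r i y) ⟩
    r i y               ∎)) (r∈ i)

  eliminate : ∀ p → ¬ c p ≈ 0ℝ → m ℕ.≤ length ws
  eliminate p cₚ≉0 = diagonal⇒≤length ws (x ∘ punchIn p) f′ diag′ off′ f′∈
    where
    f′ : Fin m → Y → ℝ
    -- Cross-multiplication cancels the `w` terms without dividing by the pivot coefficient.
    f′ i y = c p * f (punchIn p i) y - c (punchIn p i) * f p y

    f′≈ : ∀ i j → f′ i (x (punchIn p j)) ≈ c p * f (punchIn p i) (x (punchIn p j))
    f′≈ i j = begin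
      c p * F - b * f p X   ≈⟨ R.+-congˡ (R.-‿cong (R.*-congˡ (off p (punchIn p j) (Fin.punchInᵢ≢i p j ∘ ≡.sym)))) ⟩
      c p * F - b * 0ℝ      ≈⟨ ≗⇒≈ (λ n → solve 2 (λ a c → a :- c :* con 0ℚ := a) refl (seq (c p * F) n) (seq b n)) ⟩
      c p * F               ∎
      where
      X = x (punchIn p j)
      F = f (punchIn p i) X
      b = c (punchIn p i)

    diag′ : ∀ i → ¬ f′ i (x (punchIn p i)) ≈ 0ℝ
    diag′ i f′≈0 = diag (punchIn p i)
      (*-cancel-≉0 cₚ≉0 (R.trans (R.sym (f′≈ i i)) f′≈0))

    off′ : ∀ i j → i ≢ j → f′ i (x (punchIn p j)) ≈ 0ℝ
    off′ i j i≢j = R.trans (f′≈ i j) (R.trans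
      (R.*-congˡ (off _ _ (i≢j ∘ Fin.punchIn-injective p i j))) (R.zeroʳ (c p)))

    f′∈ : ∀ i → Span ws (f′ i)
    f′∈ i = resp
      (λ y → R.sym (R.trans
        (R.+-cong (R.*-congˡ (f≈ q y)) (R.-‿cong (R.*-congˡ (f≈ p y))))
        (cancel (c p) (c q) (w y) (r q y) (r p y))))
      (add (scale (c p) (r∈ q)) (scale (- c q) (r∈ p)))
      where
      q = punchIn p i
      cancel : ∀ a b w s t → a * (b * w + s) - b * (a * w + t) ≈ a * s + (- b) * t
      cancel a b w s t = ≗⇒≈ λ n → solve 5
        (λ a b w s t → a :* (b :* w :+ s) :- b :* (a :* w :+ t) := a :* s :+ (:- b) :* t) refl
        (seq a n) (seq b n) (seq w n) (seq s n) (seq t n)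

-- Homogeneous polynomials

-- Monomials are taken as functions on `Y`, those divisible by `u zero` first. Different monomials
-- may give equal functions; only the length of the list enters the bound.
monomials : ∀ {n} → (Fin n → Y → ℝ) → ℕ → List (Y → ℝ)
monomials         u zero    = (λ _ → 1ℝ) ∷ []
monomials {n = zero}  u (suc k) = []
monomials {n = suc n} u (suc k) = map (u zero ·_) (monomials u k) ++ monomials (u ∘ suc) (suc k)

-- The split by divisibility by the first variable is Pascal's rule.
length-monomials : ∀ {n} (u : Fin (suc n) → Y → ℝ) k →
  length (monomials u k) ≡ (n ℕ.+ k) C k
length-monomials u zero = refl
length-monomials {n = n} u (suc k) = ≡.trans (length-++ (map (u zero ·_) (monomials u k)))
  (≡.trans (cong₂ ℕ._+_
    (≡.trans (length-map (u zero ·_) (monomials u k)) (length-monomials u k)) (tail-length n u))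
  (≡.trans (nCk+nC[k+1]≡[n+1]C[k+1] (n ℕ.+ k) k)
    (cong (_C suc k) (≡.sym (ℕ.+-suc n k)))))
  where
  tail-length : ∀ n (u : Fin (suc n) → _ → ℝ) →
    length (monomials (u ∘ suc) (suc k)) ≡ (n ℕ.+ k) C suc k
  -- No variables remain: there is no monomial of positive degree, and `k C suc k` is 0.
  tail-length zero    u = ≡.sym (k>n⇒nCk≡0 (ℕ.n<1+n k))
  tail-length (suc n) u = ≡.trans (length-monomials (u ∘ suc) (suc k))
    (cong (_C suc k) (ℕ.+-suc n k))

coordinate-·-monomial : ∀ {n} (u : Fin n → Y → ℝ) k j {w} →
  w ∈ monomials u k → Span (monomials u (suc k)) (u j · w)
coordinate-·-monomial {n = suc n} u k zero w∈ = gen (∈-++⁺ˡ (∈-map⁺ (u zero ·_) w∈))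
coordinate-·-monomial {n = suc n} u zero (suc j) (here refl) =
  span-++ʳ {ws = map (u zero ·_) (monomials u zero)}
    (coordinate-·-monomial (u ∘ suc) zero j (here refl))
coordinate-·-monomial {n = suc n} u (suc k) (suc j) w∈
  with ∈-++⁻ (map (u zero ·_) (monomials u k)) w∈
... | inj₂ w∈ʳ = span-++ʳ {ws = map (u zero ·_) (monomials u (suc k))}
  (coordinate-·-monomial (u ∘ suc) (suc k) j w∈ʳ)
-- The monomial is `u zero · w`: the induction hypothesis moves `u (suc j)` past `u zero` onto `w`,
-- and `u zero` is multiplied back on.
... | inj₁ w∈ˡ with w , w∈ , refl ← ∈-map⁻ (u zero ·_) w∈ˡ =
  resp (λ y → x∙yz≈y∙xz (u zero y) (u (suc j) y) (w y))
    (span-· (u zero) (gen ∘ ∈-++⁺ˡ ∘ ∈-map⁺ (u zero ·_))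
      (coordinate-·-monomial u k (suc j) w∈))
  where open CommutativeSemigroupProperties R.*-commutativeSemigroup using (x∙yz≈y∙xz)

coordinate-· : ∀ {n} (u : Fin n → Y → ℝ) {k} j →
  Span (monomials u k) g → Span (monomials u (suc k)) (u j · g)
coordinate-· u j = span-· (u j) (coordinate-·-monomial u _ j)

module _ {n} (X : Y → ℝ^ n) where

  -- The coordinate functions of the points `X y` are `flip X`, and the inner product with `v` is a
  -- linear form in them.
  inner-· : ∀ {k} (v : ℝ^ n) → Span (monomials (flip X) k) g →
    Span (monomials (flip X) (suc k)) λ y → ⟨ v , X y ⟩ * g y
  inner-· {g = g} v p = resp
    (λ y → R.sym (R.trans (*-distribʳ-sum (g y) (λ j → v j * X y j))
      (sum-cong λ j → R.*-assoc (v j) (X y j) (g y))))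
    (span-sum _ λ j → scale (v j) (coordinate-· (flip X) j p))

  inner-^ : ∀ (v : ℝ^ n) k → Span (monomials (flip X) k) λ y → ⟨ v , X y ⟩ ^ k
  inner-^ v zero    = gen (here refl)
  inner-^ v (suc k) = inner-· v (inner-^ v k)

  -- On the sphere `g` may be multiplied by the sum of the squared coordinates, which is 1.
  raise-degree : (∀ y → ⟨ X y , X y ⟩ ≈ 1ℝ) → ∀ {k} →
    Span (monomials (flip X) k) g → Span (monomials (flip X) (2 ℕ.+ k)) g
  raise-degree {g = g} unit p = resp
    (λ y → begin
      sum (λ j → X y j * (X y j * g y))  ≈⟨ sum-cong (λ j → R.*-assoc (X y j) (X y j) (g y)) ⟨
      sum (λ j → X y j * X y j * g y)    ≈⟨ *-distribʳ-sum (g y) (λ j → X y j * X y j) ⟨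
      ⟨ X y , X y ⟩ * g y                ≈⟨ R.*-congʳ (unit y) ⟩
      1ℝ * g y                           ≈⟨ R.*-identityˡ (g y) ⟩
      g y                                ∎)
    (span-sum _ λ j → coordinate-· (flip X) j (coordinate-· (flip X) j p))

-- Degree s - 3; the empty list for s < 3 matches the value 0 of `_Cᶻ_` at a negative lower index.
low-monomials : ∀ {n} → (Fin n → Y → ℝ) → ℕ → List (Y → ℝ)
low-monomials u (suc (suc (suc k))) = monomials u k
low-monomials u _                   = []

-- On the sphere, a polynomial of degree at most s without terms of degree
-- s - 1 has its terms of degrees s, s - 2, … homogenised to degree s, and
-- those of degrees s - 3, s - 5, … to degree s - 3.
gapped-monomials : ∀ {n} → (Fin n → Y → ℝ) → ℕ → List (Y → ℝ)
gapped-monomials u s = monomials u s ++ low-monomials u s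

length-gapped-monomials : ∀ {n} (u : Fin (suc n) → Y → ℝ) s →
  length (gapped-monomials u s) ≡
  (suc n ℕ.+ s ∸ 1) C s ℕ.+ (suc n ℕ.+ s ∸ 4) Cᶻ (s ⊖ 3)
length-gapped-monomials {n = n} u s = ≡.trans (length-++ (monomials u s))
  (cong₂ ℕ._+_ (length-monomials u s) (length-low s))
  where
  -- The subtraction can truncate only for s < 3, where the coefficient is 0 anyway.
  length-low : ∀ s → length (low-monomials u s) ≡ (n ℕ.+ s ∸ 3) Cᶻ (s ⊖ 3)
  length-low 0 = refl
  length-low 1 = refl
  length-low 2 = refl
  length-low (suc (suc (suc k))) = ≡.trans (length-monomials u k)
    (cong (_C k) (≡.sym (ℕ.+-∸-assoc n {3 ℕ.+ k} {3} (s≤s (s≤s (s≤s z≤n))))))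

module _ {n} (X : Y → ℝ^ n) (unit : ∀ y → ⟨ X y , X y ⟩ ≈ 1ℝ) where

  -- Here `d` is the distance of the degree `j` below s - 2, so degree s - 1 is excluded. Each
  -- raising lowers `d` by two, ending at degree s - 2, which is raised once more, or at s - 3.
  span-gapped : ∀ d {j} → Span (monomials (flip X) j) g →
    Span (gapped-monomials (flip X) (2 ℕ.+ d ℕ.+ j)) g
  span-gapped 0 p = span-++ˡ (raise-degree X unit p)
  span-gapped 1 {j} p = span-++ʳ {ws = monomials (flip X) (3 ℕ.+ j)} p
  span-gapped {g = g} (suc (suc d)) {j} p =
    subst (λ s → Span (gapped-monomials (flip X) (2 ℕ.+ s)) g)
      (≡.trans (ℕ.+-suc d (suc j)) (cong suc (ℕ.+-suc d j)))
      (span-gapped d (raise-degree X unit p))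

-- Expansion of a product of linear factors

powers-below : (Y → ℝ) → ℕ → List (Y → ℝ)
powers-below z k = applyDownFrom (λ i y → z y ^ i) k

·-powers-below : ∀ (z : Y → ℝ) {k} →
  Span (powers-below z k) g → Span (powers-below z (suc k)) (z · g)
·-powers-below z = span-· z λ w∈ → gen (shift w∈)
  where
  shift : ∀ {k w} → w ∈ powers-below z k → z · w ∈ powers-below z (suc k)
  shift w∈ with i , i<k , refl ← ∈-applyDownFrom⁻ (λ i y → z y ^ i) w∈ =
    ∈-applyDownFrom⁺ (λ i y → z y ^ i) (s≤s i<k)

-- Vieta for the two leading coefficients; all lower terms go into the remainder `r`.
linear-factors : ∀ (z : Y → ℝ) k (t : Fin (suc k) → ℝ) → ∃ λ r →
  Span (powers-below z k) r ×
  ∀ y → product (λ l → z y - t l) ≈ z y ^ suc k - sum t * z y ^ k + r y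
linear-factors z zero t = _ , zero , λ y → expand (z y) (t zero)
  where
  expand : ∀ z t → (z - t) * 1ℝ ≈ z * 1ℝ - (t + 0ℝ) * 1ℝ + 0ℝ
  expand z t = ≗⇒≈ λ n → solve 2
    (λ z t → (z :- t) :* con 1ℚ :=
             z :* con 1ℚ :- (t :+ con 0ℚ) :* con 1ℚ :+ con 0ℚ) refl (seq z n) (seq t n)
linear-factors z (suc k) t =
  let r , r∈ , z-t≈ = linear-factors z k (t ∘ suc) in
  _ ,
  -- `applyDownFrom` lists the highest power first, so `here` denotes the power `k`.
  add (scale (t zero * sum (t ∘ suc)) (gen (here refl)))
      (add (·-powers-below z r∈) (scale (- t zero) (span-trans (gen ∘ there) r∈))) ,
  λ y → R.trans (R.*-congˡ (z-t≈ y))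
    (expand (z y) (z y ^ k) (sum (t ∘ suc)) (t zero) (r y))
  where
  expand : ∀ z p s t r → (z - t) * (z * p - s * p + r) ≈
    z * (z * p) - (t + s) * (z * p) + (t * s * p + (z * r + (- t) * r))
  expand z p s t r = ≗⇒≈ λ n → solve 5
    (λ z p s t r → (z :- t) :* (z :* p :- s :* p :+ r) :=
      z :* (z :* p) :- (t :+ s) :* (z :* p) :+ (t :* s :* p :+ (z :* r :+ (:- t) :* r))) refl
    (seq z n) (seq p n) (seq s n) (seq t n) (seq r n)

product-≈0 : ∀ {s} (u : Fin s → ℝ) i → u i ≈ 0ℝ → product u ≈ 0ℝ
product-≈0 u zero    u≈0 = R.trans (R.*-congʳ u≈0) (R.zeroˡ _)
product-≈0 u (suc i) u≈0 = R.trans (R.*-congˡ (product-≈0 (u ∘ suc) i u≈0)) (R.zeroʳ (u zero))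

1≉0 : ¬ 1ℝ ≈ 0ℝ
1≉0 = #0⇒≉0 (1ℚ , 0 , ℚ.positive⁻¹ 1ℚ , λ _ _ → ℚ.≤-refl)

product-≉0 : ∀ {s} (u : Fin s → ℝ) → (∀ i → ¬ u i ≈ 0ℝ) → ¬ product u ≈ 0ℝ
product-≉0 {zero}  u u≉0 = 1≉0
product-≉0 {suc s} u u≉0 = product-≉0 (u ∘ suc) (u≉0 ∘ suc) ∘ *-cancel-≉0 (u≉0 zero)

-- Points of the sphere

0≤p*p : ∀ p → 0ℚ ℚ.≤ p ℚ.* p
0≤p*p p = subst (0ℚ ℚ.≤_) ∣p∣*∣p∣≡p*p (*-mono-≤-nonNeg ℚ.≤-refl (ℚ.0≤∣p∣ p) (ℚ.0≤∣p∣ p) (ℚ.0≤∣p∣ p))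
  where
  ∣p∣*∣p∣≡p*p : ∣ p ∣ ℚ.* ∣ p ∣ ≡ p ℚ.* p
  ∣p∣*∣p∣≡p*p with ℚ.∣p∣≡p∨∣p∣≡-p p
  ... | inj₁ ∣p∣≡p  = cong₂ ℚ._*_ ∣p∣≡p ∣p∣≡p
  ... | inj₂ ∣p∣≡-p = ≡.trans (cong₂ ℚ._*_ ∣p∣≡-p ∣p∣≡-p)
    (solve 1 (λ p → (:- p) :* (:- p) := p :* p) refl p)

⟨x,x⟩-nonNeg : ∀ {n} (x : ℝ^ n) i → 0ℚ ℚ.≤ seq ⟨ x , x ⟩ i
⟨x,x⟩-nonNeg {zero}  x i = ℚ.≤-refl
⟨x,x⟩-nonNeg {suc n} x i = ℚ.+-mono-≤ (0≤p*p (seq (x zero) i)) (⟨x,x⟩-nonNeg (x ∘ suc) i)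

-- Nonnegativity holds term by term for sums of squares, so the terms of `x` are squeezed between 0
-- and those of `x + y`.
nonNeg-+-≈0 : ∀ {x y} → (∀ i → 0ℚ ℚ.≤ seq x i) → (∀ i → 0ℚ ℚ.≤ seq y i) →
  x + y ≈ 0ℝ → x ≈ 0ℝ
nonNeg-+-≈0 {x} {y} 0≤x 0≤y x+y≈0 = mk≈0 λ ε 0<ε →
  let N , x+y<ε = close-0 x+y≈0 ε 0<ε in N , λ n N≤n →
  let x≤x+y = subst (ℚ._≤ seq x n ℚ.+ seq y n) (ℚ.+-identityʳ (seq x n)) (ℚ.+-monoʳ-≤ (seq x n) (0≤y n))
  in subst (ℚ._< ε) (≡.sym (ℚ.0≤p⇒∣p∣≡p (0≤x n)))
       (ℚ.≤-<-trans x≤x+y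
         (subst (ℚ._< ε) (ℚ.0≤p⇒∣p∣≡p (ℚ.≤-trans (0≤x n) x≤x+y)) (x+y<ε n N≤n)))

⟨x,x⟩≈0⇒x≈0 : ∀ {n} (x : ℝ^ n) → ⟨ x , x ⟩ ≈ 0ℝ → ∀ i → x i ≈ 0ℝ
⟨x,x⟩≈0⇒x≈0 x xx≈0 zero = x*x≈0⇒x≈0 (nonNeg-+-≈0
  (λ i → 0≤p*p (seq (x zero) i)) (⟨x,x⟩-nonNeg (x ∘ suc)) xx≈0)
⟨x,x⟩≈0⇒x≈0 x xx≈0 (suc i) = ⟨x,x⟩≈0⇒x≈0 (x ∘ suc) (nonNeg-+-≈0
  (⟨x,x⟩-nonNeg (x ∘ suc)) (λ i → 0≤p*p (seq (x zero) i)) (R.trans (R.+-comm _ _) xx≈0)) i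

⟨x-y,x-y⟩ : ∀ {n} (x y : ℝ^ n) →
  ⟨ x -ᵛ y , x -ᵛ y ⟩ ≈ (⟨ x , x ⟩ - ⟨ x , y ⟩) + (⟨ y , y ⟩ - ⟨ x , y ⟩)
⟨x-y,x-y⟩ {zero}  x y = ≗⇒≈ λ _ → refl
⟨x-y,x-y⟩ {suc n} x y = R.trans (R.+-congˡ (⟨x-y,x-y⟩ (x ∘ suc) (y ∘ suc)))
  (expand (x zero) (y zero) _ _ _)
  where
  expand : ∀ a b p q r → (a - b) * (a - b) + ((p - q) + (r - q)) ≈
    ((a * a + p) - (a * b + q)) + ((b * b + r) - (a * b + q))
  expand a b p q r = ≗⇒≈ λ n → solve 5
    (λ a b p q r → (a :- b) :* (a :- b) :+ ((p :- q) :+ (r :- q)) :=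
      ((a :* a :+ p) :- (a :* b :+ q)) :+ ((b :* b :+ r) :- (a :* b :+ q))) refl
    (seq a n) (seq b n) (seq p n) (seq q n) (seq r n)

-- The equality case of Cauchy-Schwarz: the squared distance is (1 - 1) + (1 - 1). It keeps 1 out of
-- the inner products of distinct points.
unit-inner-1⇒≈ : ∀ {n} {x y : ℝ^ n} → ⟨ x , x ⟩ ≈ 1ℝ → ⟨ y , y ⟩ ≈ 1ℝ →
  ⟨ x , y ⟩ ≈ 1ℝ → x ≈ᵛ y
unit-inner-1⇒≈ {x = x} {y} xx≈1 yy≈1 xy≈1 i = x-y≈0⇒x≈y (⟨x,x⟩≈0⇒x≈0 (x -ᵛ y) (begin
  ⟨ x -ᵛ y , x -ᵛ y ⟩                                ≈⟨ ⟨x-y,x-y⟩ x y ⟩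
  (⟨ x , x ⟩ - ⟨ x , y ⟩) + (⟨ y , y ⟩ - ⟨ x , y ⟩)  ≈⟨ R.+-cong (1-1 xx≈1) (1-1 yy≈1) ⟩
  0ℝ + 0ℝ                                            ≈⟨ R.+-identityˡ 0ℝ ⟩
  0ℝ                                                 ∎) i)
  where
  1-1 : ∀ {a} → a ≈ 1ℝ → a - ⟨ x , y ⟩ ≈ 0ℝ
  1-1 a≈1 = R.trans (R.+-cong a≈1 (R.-‿cong xy≈1)) (R.-‿inverseʳ 1ℝ)

-- The annihilator polynomials and the bound

-- The leading power is homogeneous of degree s, the power s - 1 has coefficient `- sum t`, which
-- vanishes, and `span-gapped` handles every lower power.
annihilator∈gapped : ∀ {n} (X : Y → ℝ^ n) → (∀ y → ⟨ X y , X y ⟩ ≈ 1ℝ) →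
  ∀ s .{{_ : NonZero s}} (t : Fin s → ℝ) → sum t ≈ 0ℝ → ∀ v →
  Span (gapped-monomials (flip X) s) λ y → product (λ l → ⟨ v , X y ⟩ - t l)
annihilator∈gapped X unit (suc k) t Σt≈0 v =
  let z = λ y → ⟨ v , X y ⟩
      r , r∈ , ∏≈ = linear-factors z k t
  in resp (λ y → R.sym (R.trans (∏≈ y) (R.+-congʳ (drop (z y)))))
       (add (span-++ˡ (inner-^ X v (suc k))) (span-trans lower∈ r∈))
  where
  drop : ∀ z → z ^ suc k - sum t * z ^ k ≈ z ^ suc k
  drop z = begin
    z ^ suc k - sum t * z ^ k  ≈⟨ R.+-congˡ (R.-‿cong (R.trans (R.*-congʳ Σt≈0) (R.zeroˡ (z ^ k)))) ⟩
    z ^ suc k - 0ℝ             ≈⟨ ≗⇒≈ (λ n → ℚ.+-identityʳ (seq (z ^ suc k) n)) ⟩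
    z ^ suc k                  ∎

  lower∈ : ∀ {w} → w ∈ powers-below (λ y → ⟨ v , X y ⟩) k →
    Span (gapped-monomials (flip X) (suc k)) w
  lower∈ {w} w∈ with i , i<k , refl ← ∈-applyDownFrom⁻ (λ i y → ⟨ v , X y ⟩ ^ i) w∈ =
    subst (λ s → Span (gapped-monomials (flip X) (suc s)) w)
      -- With s = `suc k` and i < k, the distance of i below s - 2 is `k ∸ suc i`.
      (≡.trans (≡.sym (ℕ.+-suc (k ∸ suc i) i)) (ℕ.m∸n+n≡m i<k))
      (span-gapped X unit (k ∸ suc i) (inner-^ X v i))

theorem3p1 : (n s : ℕ) .{{_ : NonZero n}} .{{_ : NonZero s}} →
    (F : Pred (ℝ^ n) 0ℓ) →
    IsSphericalDistanceSet F s →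
    (t : Fin s → ℝ) →
    Enumerates _≈_ t (InnerProducts F) →
    sum t ≈ 0ℝ →
    ∀ m → HasCardinality _≈ᵛ_ F m →
    m ℕ.≤ (n ℕ.+ s ∸ 1) C s ℕ.+ (n ℕ.+ s ∸ 4) Cᶻ (s ⊖ 3)
theorem3p1 (suc n) s F (_ , F⊆sphere) t (t∈ , _ , t-covers) Σt≈0 m (e , e∈ , e-injective , _) =
  subst (m ℕ.≤_) (length-gapped-monomials (flip e) s)
    -- Only values at the points of `F` matter, so the domain is the index set `Fin m` and the
    -- evaluation points are given by `id`.
    (diagonal⇒≤length (gapped-monomials (flip e) s) id f diag off
      (λ i → annihilator∈gapped e (λ j → unit (e∈ j)) s t Σt≈0 (e i)))
  where
  unit : ∀ {x} → F x → ⟨ x , x ⟩ ≈ 1ℝ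
  unit {x} x∈ = R.trans (R.sym (proj₂ (F⊆sphere x x∈))) (R.*-identityˡ 1ℝ)

  f : Fin m → Fin m → ℝ
  f i j = product (λ l → ⟨ e i , e j ⟩ - t l)

  diag : ∀ i → ¬ f i i ≈ 0ℝ
  -- A vanishing factor would make some `t l` equal to 1, so the distinct points realising `t l`
  -- would coincide.
  diag i = product-≉0 _ λ l 1-t≈0 →
    let x , y , x∈ , y∈ , x≉y , xy≈t = t∈ l in
    x≉y (unit-inner-1⇒≈ (unit x∈) (unit y∈)
      (R.trans xy≈t (R.trans (R.sym (x-y≈0⇒x≈y 1-t≈0)) (unit (e∈ i)))))

  off : ∀ i j → i ≢ j → f i j ≈ 0ℝ
  off i j i≢j =
    let l , ij≈t = t-covers ⟨ e i , e j ⟩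
          (e i , e j , e∈ i , e∈ j , (λ eᵢ≈eⱼ → i≢j (e-injective eᵢ≈eⱼ)) , R.refl)
    in product-≈0 _ l (R.trans (R.+-congʳ ij≈t) (R.-‿inverseʳ (t l)))
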